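{- Let $G$ be a finite simple graph with girth $g \in \{7,8,9,10\}$ and minimum degree $\delta \ge 2$. Then $F(G) \ge \delta + (\delta-2)(g-3)$.
   Context: The girth of a graph is the length of a shortest cycle in it. The forcing process on $G$: start with a set $S \subseteq V(G)$ of colored vertices, all other vertices non-colored; at each step, a colored vertex with exactly one non-colored neighbor forces that neighbor to become colored. $S$ is a forcing set if iterating this process eventually colors all of $V(G)$. The forcing number (zero forcing number) $F(G)$ is the minimum cardinality of a forcing set of $G$. -}

module Defs where

open import Data.Nat using (ℕ; suc; _+_; _*_; _∸_; _≤_; _<_; _<?_; s≤s)
open import Data.Fin using (Fin; zero; toℕ; fromℕ<)
open import Data.Fin.Subset using (Subset; _∈_; _∉_; _∪_; ⁅_⁆; ⊤; ∣_∣)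
open import Data.Vec using (tabulate)
open import Data.Bool using (Bool; true; false)
open import Data.Product using (Σ; ∃; _×_; _,_)
open import Function.Definitions using (Injective)
open import Relation.Binary.PropositionalEquality using (_≡_)
open import Relation.Nullary using (¬_; yes; no)

record Graph (n : ℕ) : Set where
  field
    adj   : Fin n → Fin n → Bool
    sym   : ∀ u v → adj u v ≡ adj v u
    irrefl : ∀ v → adj v v ≡ false

open Graph public

Adj : ∀ {n} → Graph n → Fin n → Fin n → Set
Adj G u v = adj G u v ≡ true

N : ∀ {n} → Graph n → Fin n → Subset n
N G v = tabulate (adj G v)

deg : ∀ {n} → Graph n → Fin n → ℕ
deg G v = ∣ N G v ∣

IsMinDegree : ∀ {n} → Graph n → ℕ → Set
IsMinDegree {n} G δ = (∀ v → δ ≤ deg G v) × ∃ λ v → deg G v ≡ δ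

next : ∀ {k} → Fin k → Fin k
next {suc k} i with toℕ i <? k
... | yes p = fromℕ< (s≤s p)
... | no _  = zero

HasCycleOfLength : ∀ {n} → Graph n → ℕ → Set
HasCycleOfLength {n} G k =
  3 ≤ k × Σ (Fin k → Fin n) λ c → Injective _≡_ _≡_ c × (∀ i → Adj G (c i) (c (next i)))

IsGirth : ∀ {n} → Graph n → ℕ → Set
IsGirth G g = HasCycleOfLength G g × (∀ k → k < g → ¬ HasCycleOfLength G k)

ForceStep : ∀ {n} → Graph n → Subset n → Subset n → Set
ForceStep {n} G C C' = Σ (Fin n) λ u → Σ (Fin n) λ w →
  u ∈ C × Adj G u w × w ∉ C × (∀ x → Adj G u x → x ∉ C → x ≡ w) × C' ≡ C ∪ ⁅ w ⁆

data Reaches {n} (G : Graph n) : Subset n → Subset n → Set where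
  done : ∀ {C} → Reaches G C C
  step : ∀ {C C' D} → ForceStep G C C' → Reaches G C' D → Reaches G C D

IsForcingSet : ∀ {n} → Graph n → Subset n → Set
IsForcingSet G S = Reaches G S ⊤

IsForcingNumber : ∀ {n} → Graph n → ℕ → Set
IsForcingNumber G f =
  (∃ λ S → IsForcingSet G S × ∣ S ∣ ≡ f) × (∀ S → IsForcingSet G S → f ≤ ∣ S ∣)

{-# OPTIONS --safe #-}
module Submission where

-- Every vertex forces at most once, so after t forces the forcers form a set U of t vertices with
-- |N[U]| ≤ |S| + t; if fewer forces suffice, U can be padded arbitrarily.  It is therefore enough
-- that |N[U]| ≥ (δ − 1)|U| + 2 for every set U of g − 2 vertices, forcers or not.
--
-- Split U into clusters, starting with singletons and merging two clusters as long as an edge joins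
-- them.  Each cluster K satisfies the bound itself, since by the girth the closed neighbourhoods of
-- two clusters joined by an edge ab meet in {a, b} only.  If m clusters remain, the overlaps of their
-- closed neighbourhoods may lose 2(m − 1) in total.  By the girth two clusters share at most one
-- neighbour when m ≥ 3, and when m ≥ 5 the graph "share a neighbour" on the clusters behaves like a
-- triangle-free one, so Mantel's argument bounds the loss by ⌊m²/4⌋ ≤ 2(m − 1) for m ≤ 7.  For m = 8
-- it behaves like a graph without 4-cycles as well, and removing a path of three clusters suffices.
-- For m = 2 the bound is proved one merge earlier, at m = 3.

open import Defs
open import Data.Bool using (true; false)
open import Data.Empty using (⊥-elim)
open import Data.Fin using (Fin; zero; suc; toℕ)
open import Data.Fin.Properties using (_≟_; toℕ-fromℕ<; injective⇒≤; any?)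
open import Data.Fin.Subset
  using (Subset; _∈_; _∉_; _∪_; _∩_; ⁅_⁆; ⊤; ⊥; ∣_∣; ⋃; _⊆_; Nonempty; Empty)
open import Data.Fin.Subset.Properties
  using (x∈⁅x⁆; x∈⁅y⁆⇒x≡y; ∣⁅x⁆∣≡1; ∣⊥∣≡0; Empty-unique; ∉⊥; ∈⊤; nonempty?; _∈?_; p⊆q⇒∣p∣≤∣q∣;
         x∈p∪q⁻; x∈p∪q⁺; x∈p∩q⁻; x∈p∩q⁺; ∩-distribˡ-∪; ∣p∣≤∣p∪q∣)
open import Data.List using (List; []; _∷_; _++_; length; lookup; map)
open import Data.List.Membership.DecPropositional using () renaming (_∈?_ to mem?)
open import Data.List.Membership.Propositional using (find; lose) renaming (_∈_ to _∈ˡ_; _∉_ to _∉ˡ_)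
open import Data.List.Membership.Propositional.Properties using (∈-lookup; ∈-++⁺ˡ; ∈-++⁺ʳ; ∈-++⁻; ∈-∃++)
open import Data.List.Properties using (length-++; length-map)
open import Data.List.Relation.Binary.Permutation.Propositional
  using (_↭_; ↭-refl; ↭-sym; ↭-trans; prep; swap; ↭⇒↭ₛ)
open import Data.List.Relation.Binary.Permutation.Propositional.Properties
  using (↭-length; Any-resp-↭; map⁺; shift)
import Data.List.Relation.Binary.Permutation.Setoid.Properties as PermSetoid
open import Data.List.Relation.Unary.All as All using (All; []; _∷_)
import Data.List.Relation.Unary.All.Properties as All
open import Data.List.Relation.Unary.AllPairs as AllPairs using (AllPairs; []; _∷_)
import Data.List.Relation.Unary.AllPairs.Properties as AllPairs
open import Data.List.Relation.Unary.Any as Any using (Any; here; there; index)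
import Data.List.Relation.Unary.Any.Properties as Any
open import Data.List.Relation.Unary.Unique.Propositional using (Unique)
import Data.List.Relation.Unary.Unique.Propositional.Properties as Unique
open import Data.Nat using (ℕ; zero; suc; _+_; _*_; _∸_; _≤_; _<_; _<?_; z≤n; s≤s)
open import Data.Nat.ListAction using (sum)
open import Data.Nat.ListAction.Properties using (sum-↭)
open import Data.Nat.Properties
  using (≤-refl; ≤-trans; ≤-reflexive; n≤1+n; m≤m+n; m≤n+m; m≤n⇒m≤1+n; ≮⇒≥; <⇒≱; suc-injective;
         +-suc; +-comm; +-identityʳ; *-zeroʳ; +-mono-≤; +-monoˡ-≤; +-monoʳ-≤; +-cancelˡ-≤; +-cancelʳ-≤)
open import Data.Nat.Tactic.RingSolver using (solve-∀)
open import Data.Product using (∃; ∃₂; _×_; _,_; proj₁; proj₂)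
open import Data.Sum as Sum using (_⊎_; inj₁; inj₂; [_,_]′)
open import Data.Vec using ([]; _∷_)
open import Data.Vec.Properties using ([]=⇒lookup; lookup⇒[]=; lookup∘tabulate)
open import Function using (_∘_; id; _on_)
open import Function.Definitions using (Injective)
open import Level using (0ℓ)
open import Relation.Binary using (Rel; Symmetric; Decidable)
open import Relation.Binary.PropositionalEquality as ≡ using (_≡_; _≢_; refl; cong; cong₂; subst)
open import Relation.Nullary using (¬_; Dec; yes; no; contradiction; ¬?)
open import Relation.Nullary.Decidable using (decidable-stable)

-- Walks, loop erasure and short cycles.

lookup-injective : ∀ {A : Set} {xs : List A} → Unique xs → Injective _≡_ _≡_ (lookup xs)
lookup-injective {xs = _ ∷ _} _ {zero} {zero} _ = refl
lookup-injective {xs = _ ∷ xs} (x∉ ∷ _) {zero} {suc j} eq =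
  contradiction eq (All.lookup x∉ (∈-lookup {xs = xs} j))
lookup-injective {xs = _ ∷ xs} (x∉ ∷ _) {suc i} {zero} eq =
  contradiction (≡.sym eq) (All.lookup x∉ (∈-lookup {xs = xs} i))
lookup-injective {xs = _ ∷ _} (_ ∷ u) {suc i} {suc j} eq = cong suc (lookup-injective u eq)

module _ {n} (G : Graph n) where

  adj-sym : ∀ {u v} → Adj G u v → Adj G v u
  adj-sym {u} {v} uv = ≡.trans (Graph.sym G v u) uv

  data Chain : Fin n → List (Fin n) → Fin n → Set where
    [_] : ∀ x → Chain x (x ∷ []) x
    _∷_ : ∀ {x y z vs} → Adj G x y → Chain y vs z → Chain x (x ∷ vs) z

  infixr 5 _∷_

  chain-join : ∀ {x y x′ y′ vs ws} → Chain x vs y → Adj G y x′ → Chain x′ ws y′ →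
               Chain x (vs ++ ws) y′
  chain-join [ _ ] e d = e ∷ d
  chain-join (e′ ∷ c) e d = e′ ∷ chain-join c e d

  -- `ℓ` bounds the number of edges, hence `suc ℓ` for a list that contains both ends. Vertices may
  -- repeat; loops are erased only when a cycle is built.
  record Walk (P : Fin n → Set) (x y : Fin n) (ℓ : ℕ) : Set where
    constructor walk
    field
      {verts} : List (Fin n)
      chain   : Chain x verts y
      inside  : All P verts
      short   : length verts ≤ suc ℓ

  stay : ∀ {P x} → P x → Walk P x x 0
  stay px = walk [ _ ] (px ∷ []) ≤-refl

  join : ∀ {P x y x′ y′ k ℓ} → Walk P x y k → Adj G y x′ → Walk P x′ y′ ℓ →
         Walk P x y′ (suc (k + ℓ))
  join {k = k} {ℓ} (walk {vs} c p s) e (walk c′ p′ s′) = walk (chain-join c e c′) (All.++⁺ p p′)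
    (≤-trans (≤-reflexive (length-++ vs)) (≤-trans (+-mono-≤ s s′) (≤-reflexive (cong suc (+-suc k ℓ)))))

  relax : ∀ {P Q x y k ℓ} → (∀ {v} → P v → Q v) → k ≤ ℓ → Walk P x y k → Walk Q x y ℓ
  relax f k≤ℓ (walk c p s) = walk c (All.map f p) (≤-trans s (s≤s k≤ℓ))

  suffix-from : ∀ {P : Fin n → Set} {x y z vs} → x ∈ˡ vs → Chain y vs z → Unique vs → All P vs →
    ∃ λ ws → Chain x ws z × Unique ws × All P ws × length ws ≤ length vs
  suffix-from (here refl) c@([ _ ]) u p = _ , c , u , p , ≤-refl
  suffix-from (here refl) c@(_ ∷ _) u p = _ , c , u , p , ≤-refl
  suffix-from (there x∈) (_ ∷ c) (_ ∷ u) (_ ∷ p) =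
    let ws , c′ , u′ , p′ , s = suffix-from x∈ c u p in ws , c′ , u′ , p′ , m≤n⇒m≤1+n s

  erase-loops : ∀ {P : Fin n → Set} {x y vs} → Chain x vs y → All P vs →
    ∃ λ ws → Chain x ws y × Unique ws × All P ws × length ws ≤ length vs
  erase-loops [ x ] p = _ , [ x ] , [] ∷ [] , p , ≤-refl
  erase-loops {x = x} (e ∷ c) (px ∷ p) with erase-loops c p
  ... | ws , c′ , u , p′ , s with mem? _≟_ x ws
  ...   | yes x∈ = let ws′ , c″ , u′ , p″ , s′ = suffix-from x∈ c′ u p′
                   in ws′ , c″ , u′ , p″ , m≤n⇒m≤1+n (≤-trans s′ s)
  ...   | no x∉ = _ , e ∷ c′ , All.¬Any⇒All¬ _ x∉ ∷ u , px ∷ p′ , s≤s s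

  chain-step : ∀ {x y vs} → Chain x vs y → (i j : Fin (length vs)) → toℕ j ≡ suc (toℕ i) →
               Adj G (lookup vs i) (lookup vs j)
  chain-step (e ∷ [ _ ]) zero (suc zero) _ = e
  chain-step (e ∷ _ ∷ _) zero (suc zero) _ = e
  chain-step (_ ∷ c) (suc i) (suc j) eq = chain-step c i j (suc-injective eq)
  chain-step [ _ ] zero (suc ()) _

  chain-last : ∀ {x y vs} → Chain x vs y → (i : Fin (length vs)) → length vs ≤ suc (toℕ i) →
               lookup vs i ≡ y
  chain-last [ _ ] zero _ = refl
  chain-last (_ ∷ c) (suc i) (s≤s le) = chain-last c i le
  chain-last (_ ∷ [ _ ]) zero (s≤s ())
  chain-last (_ ∷ _ ∷ _) zero (s≤s ())

  chain-first : ∀ {x y v vs} → Chain x (v ∷ vs) y → v ≡ x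
  chain-first [ _ ] = refl
  chain-first (_ ∷ _) = refl

  closed-chain⇒cycle : ∀ {x y vs} → Chain x vs y → Adj G y x → Unique vs → 3 ≤ length vs →
                       HasCycleOfLength G (length vs)
  closed-chain⇒cycle {vs = v ∷ vs} c e u 3≤ = 3≤ , lookup (v ∷ vs) , lookup-injective u , adjacent
    where
    adjacent : ∀ i → Adj G (lookup (v ∷ vs) i) (lookup (v ∷ vs) (next i))
    adjacent i with toℕ i <? length vs
    ... | yes p = chain-step c i _ (cong suc (toℕ-fromℕ< p))
    -- At the last index `next` wraps around to `zero`, so the edge required is the closing one from
    -- `y` to `x`.
    ... | no ¬p rewrite chain-last c i (s≤s (≮⇒≥ ¬p)) | chain-first c = e

  2≤length : ∀ {x y vs} → x ≢ y → Chain x vs y → 2 ≤ length vs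
  2≤length x≢y [ _ ] = contradiction refl x≢y
  2≤length x≢y (_ ∷ [ _ ]) = s≤s (s≤s z≤n)
  2≤length x≢y (_ ∷ _ ∷ _) = s≤s (s≤s z≤n)

  1≤length : ∀ {x y vs} → Chain x vs y → 1 ≤ length vs
  1≤length [ _ ] = s≤s z≤n
  1≤length (_ ∷ _) = s≤s z≤n

  module _ {g} (acyclic : ∀ k → k < g → ¬ HasCycleOfLength G k) where

    -- After loop erasure the two walks are disjoint paths, one inside P and one outside, so they close
    -- up to a cycle; the inequality hypothesis keeps it from degenerating to a single edge.
    no-short-cycle : ∀ {P a a′ b b′ k ℓ} → Walk P a a′ k → Adj G a′ b → Walk (¬_ ∘ P) b b′ ℓ → Adj G b′ a →
                a ≢ a′ ⊎ b ≢ b′ → 2 + k + ℓ < g → ∀ {A : Set} → A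
    no-short-cycle {k = k} {ℓ} (walk c p s) e (walk c′ p′ s′) e′ ≢ lt
      with erase-loops c p | erase-loops c′ p′
    ... | vs , d , u , q , t | ws , d′ , u′ , q′ , t′ = contradiction
      (closed-chain⇒cycle (chain-join d e d′) e′
        (Unique.++⁺ u u′ λ (v∈ , w∈) → All.lookup q′ w∈ (All.lookup q v∈))
        (≤-trans (3≤ ≢) (≤-reflexive (≡.sym (length-++ vs)))))
      (acyclic _ (≤-trans (s≤s (≤-trans (≤-reflexive (length-++ vs))
        (≤-trans (+-mono-≤ (≤-trans t s) (≤-trans t′ s′)) (≤-reflexive (cong suc (+-suc k ℓ)))))) lt))
      where
      3≤ : _ → 3 ≤ length vs + length ws
      3≤ (inj₁ a≢a′) = +-mono-≤ (2≤length a≢a′ d) (1≤length d′)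
      3≤ (inj₂ b≢b′) = +-mono-≤ (1≤length d) (2≤length b≢b′ d′)

-- Inequalities and cardinalities of unions.

-- Several hypotheses are summed into one inequality `L ≤ R`; what remains is then a ring identity,
-- and no subtraction occurs.
≤-from : ∀ {L R a b} → L ≤ R → a + R ≤ b + L → a ≤ b
≤-from {L} {R} {a} {b} p q = +-cancelʳ-≤ L a b (≤-trans (+-monoʳ-≤ a p) q)

∣p∪q∣+∣p∩q∣ : ∀ {n} (p q : Subset n) → ∣ p ∪ q ∣ + ∣ p ∩ q ∣ ≡ ∣ p ∣ + ∣ q ∣
∣p∪q∣+∣p∩q∣ [] [] = refl
∣p∪q∣+∣p∩q∣ (false ∷ p) (false ∷ q) = ∣p∪q∣+∣p∩q∣ p q
∣p∪q∣+∣p∩q∣ (true ∷ p) (false ∷ q) = cong suc (∣p∪q∣+∣p∩q∣ p q)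
∣p∪q∣+∣p∩q∣ (false ∷ p) (true ∷ q) =
  ≡.trans (cong suc (∣p∪q∣+∣p∩q∣ p q)) (≡.sym (+-suc ∣ p ∣ ∣ q ∣))
∣p∪q∣+∣p∩q∣ (true ∷ p) (true ∷ q) = cong suc (≡.trans (+-suc _ _)
  (≡.trans (cong suc (∣p∪q∣+∣p∩q∣ p q)) (≡.sym (+-suc ∣ p ∣ ∣ q ∣))))

∣p∪q∣≤∣p∣+∣q∣ : ∀ {n} (p q : Subset n) → ∣ p ∪ q ∣ ≤ ∣ p ∣ + ∣ q ∣
∣p∪q∣≤∣p∣+∣q∣ p q = ≤-trans (m≤m+n _ _) (≤-reflexive (∣p∪q∣+∣p∩q∣ p q))

∣p∣+∣q∣≤∣p∪q∣+k : ∀ {n k} (p q : Subset n) → ∣ p ∩ q ∣ ≤ k → ∣ p ∣ + ∣ q ∣ ≤ ∣ p ∪ q ∣ + k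
∣p∣+∣q∣≤∣p∪q∣+k p q le = ≤-trans (≤-reflexive (≡.sym (∣p∪q∣+∣p∩q∣ p q))) (+-monoʳ-≤ ∣ p ∪ q ∣ le)

Empty⇒∣p∣≤0 : ∀ {n} {p : Subset n} → Empty p → ∣ p ∣ ≤ 0
Empty⇒∣p∣≤0 {n} e = ≤-reflexive (≡.trans (cong ∣_∣ (Empty-unique e)) (∣⊥∣≡0 n))

all-equal⇒∣p∣≤1 : ∀ {n} (p : Subset n) → (∀ {x y} → x ∈ p → y ∈ p → x ≡ y) → ∣ p ∣ ≤ 1
all-equal⇒∣p∣≤1 p eq with nonempty? p
... | no e = ≤-trans (Empty⇒∣p∣≤0 e) z≤n
... | yes (x , x∈) = ≤-trans (p⊆q⇒∣p∣≤∣q∣ λ y∈ → subst (_∈ ⁅ x ⁆) (eq x∈ y∈) (x∈⁅x⁆ x))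
                             (≤-reflexive (∣⁅x⁆∣≡1 x))

∣⁅a⁆∪⁅b⁆∣≤2 : ∀ {n} (a b : Fin n) → ∣ ⁅ a ⁆ ∪ ⁅ b ⁆ ∣ ≤ 2
∣⁅a⁆∪⁅b⁆∣≤2 a b = ≤-trans (∣p∪q∣≤∣p∣+∣q∣ ⁅ a ⁆ ⁅ b ⁆)
  (≤-reflexive (cong₂ _+_ (∣⁅x⁆∣≡1 a) (∣⁅x⁆∣≡1 b)))

∈⋃⁺ : ∀ {n} {x : Fin n} {ps} → Any (x ∈_) ps → x ∈ ⋃ ps
∈⋃⁺ {ps = p ∷ ps} (here x∈) = x∈p∪q⁺ (inj₁ x∈)
∈⋃⁺ {ps = p ∷ ps} (there x∈) = x∈p∪q⁺ {p = p} (inj₂ (∈⋃⁺ x∈))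

∈⋃⁻ : ∀ {n} {x : Fin n} ps → x ∈ ⋃ ps → Any (x ∈_) ps
∈⋃⁻ [] x∈ = contradiction x∈ ∉⊥
∈⋃⁻ (p ∷ ps) x∈ = [ here , there ∘ ∈⋃⁻ ps ]′ (x∈p∪q⁻ p (⋃ ps) x∈)

∣p∩⋃∣≤length : ∀ {n} (p : Subset n) {qs} → All (λ q → ∣ p ∩ q ∣ ≤ 1) qs → ∣ p ∩ ⋃ qs ∣ ≤ length qs
∣p∩⋃∣≤length p [] = Empty⇒∣p∣≤0 λ (_ , x∈) → ∉⊥ (proj₂ (x∈p∩q⁻ p _ x∈))
∣p∩⋃∣≤length p {q ∷ qs} (le ∷ les) = ≤-trans
  (≤-reflexive (cong ∣_∣ (∩-distribˡ-∪ p q (⋃ qs))))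
  (≤-trans (∣p∪q∣≤∣p∣+∣q∣ (p ∩ q) (p ∩ ⋃ qs)) (+-mono-≤ le (∣p∩⋃∣≤length p les)))

-- Closed neighbourhoods, separation and connectedness.

module _ {n} (G : Graph n) where

  -- Opaque so that A can be inferred from Nb A.
  opaque

    N[_] : Fin n → Subset n
    N[ v ] = ⁅ v ⁆ ∪ N G v

    Nb : List (Fin n) → Subset n
    Nb A = ⋃ (map N[_] A)

    ∈N⇒Adj : ∀ {v x} → x ∈ N G v → Adj G v x
    ∈N⇒Adj {v} {x} x∈ = ≡.trans (≡.sym (lookup∘tabulate (adj G v) x)) ([]=⇒lookup x∈)

    Adj⇒∈N : ∀ {v x} → Adj G v x → x ∈ N G v
    Adj⇒∈N {v} {x} e = lookup⇒[]= x _ (≡.trans (lookup∘tabulate (adj G v) x) e)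

    ∈N[]⁻ : ∀ {v x} → x ∈ N[ v ] → x ≡ v ⊎ Adj G v x
    ∈N[]⁻ {v} x∈ = [ inj₁ ∘ x∈⁅y⁆⇒x≡y v , inj₂ ∘ ∈N⇒Adj ]′ (x∈p∪q⁻ ⁅ v ⁆ (N G v) x∈)

    ∈Nb⁻ : ∀ {A x} → x ∈ Nb A → x ∈ˡ A ⊎ ∃ λ a → a ∈ˡ A × Adj G a x
    ∈Nb⁻ {A} x∈ with find (Any.map⁻ (∈⋃⁻ (map N[_] A) x∈))
    ... | a , a∈ , x∈′ with ∈N[]⁻ x∈′
    ...   | inj₁ refl = inj₁ a∈
    ...   | inj₂ e = inj₂ (a , a∈ , e)

    ∈⇒∈Nb : ∀ {A x} → x ∈ˡ A → x ∈ Nb A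
    ∈⇒∈Nb {x = x} x∈ = ∈⋃⁺ (Any.map⁺ (lose x∈ (x∈p∪q⁺ (inj₁ (x∈⁅x⁆ x)))))

    Adj⇒∈Nb : ∀ {A a x} → a ∈ˡ A → Adj G a x → x ∈ Nb A
    Adj⇒∈Nb {a = a} a∈ e = ∈⋃⁺ (Any.map⁺ (lose a∈ (x∈p∪q⁺ {p = ⁅ a ⁆} (inj₂ (Adj⇒∈N e)))))

    Nb-++⁻ : ∀ A {B x} → x ∈ Nb (A ++ B) → x ∈ Nb A ⊎ x ∈ Nb B
    Nb-++⁻ A x∈ = [ inj₁ ∘ ∈⋃⁺ ∘ Any.map⁺ , inj₂ ∘ ∈⋃⁺ ∘ Any.map⁺ ]′
      (Any.++⁻ A (Any.map⁻ (∈⋃⁻ (map N[_] (A ++ _)) x∈)))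

    Nb-++⁺ : ∀ A {B x} → x ∈ Nb A ⊎ x ∈ Nb B → x ∈ Nb (A ++ B)
    Nb-++⁺ A (inj₁ x∈) = ∈⋃⁺ (Any.map⁺ (Any.++⁺ˡ (Any.map⁻ (∈⋃⁻ (map N[_] A) x∈))))
    Nb-++⁺ A {B} (inj₂ x∈) = ∈⋃⁺ (Any.map⁺ (Any.++⁺ʳ A (Any.map⁻ (∈⋃⁻ (map N[_] B) x∈))))

  ∣Nb∣+∣Nb∣≤ : ∀ {k} A B → ∣ Nb A ∩ Nb B ∣ ≤ k → ∣ Nb A ∣ + ∣ Nb B ∣ ≤ ∣ Nb (A ++ B) ∣ + k
  ∣Nb∣+∣Nb∣≤ {k} A B le = ≤-trans (∣p∣+∣q∣≤∣p∪q∣+k (Nb A) (Nb B) le)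
    (+-monoˡ-≤ k (p⊆q⇒∣p∣≤∣q∣ (Nb-++⁺ A ∘ x∈p∪q⁻ (Nb A) (Nb B))))

  Disjoint : List (Fin n) → List (Fin n) → Set
  Disjoint A B = ∀ {x} → x ∈ˡ A → x ∉ˡ B

  -- As `Nb B` contains `B`, this excludes common vertices as well as edges between the two sets.
  Separated : List (Fin n) → List (Fin n) → Set
  Separated A B = ∀ {x} → x ∈ˡ A → x ∉ Nb B

  separated-sym : ∀ {A B} → Separated A B → Separated B A
  separated-sym sep x∈B x∈NbA with ∈Nb⁻ x∈NbA
  ... | inj₁ x∈A = sep x∈A (∈⇒∈Nb x∈B)
  ... | inj₂ (a , a∈ , e) = sep a∈ (Adj⇒∈Nb x∈B (adj-sym G e))

  separated-++ : ∀ A {B C} → Separated A C → Separated B C → Separated (A ++ B) C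
  separated-++ A s t x∈ = [ s , t ]′ (∈-++⁻ A x∈)

  separated? : ∀ A B → Dec (Separated A B)
  separated? A B with Any.any? (_∈? Nb B) A
  ... | yes p = no λ s → let _ , x∈ , x∈′ = find p in s x∈ x∈′
  ... | no ¬p = yes λ x∈ x∈′ → ¬p (lose x∈ x∈′)

  ¬separated⇒edge : ∀ {A B} → Disjoint A B → ¬ Separated A B →
                     ∃ λ a → ∃ λ b → a ∈ˡ A × b ∈ˡ B × Adj G a b
  ¬separated⇒edge {A} {B} dis ¬s with Any.any? (_∈? Nb B) A
  ... | no ¬p = ⊥-elim (¬s λ x∈ x∈′ → ¬p (lose x∈ x∈′))
  ... | yes p with find p
  ...   | a , a∈ , a∈′ with ∈Nb⁻ a∈′
  ...     | inj₁ a∈B = contradiction a∈B (dis a∈)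
  ...     | inj₂ (b , b∈ , e) = a , b , a∈ , b∈ , adj-sym G e

  -- The region `P` is independent of `A`: membership in `A` gives connectedness inside `A`, and
  -- avoidance of a set `C` gives what `Loose` needs.
  Connected : (Fin n → Set) → ℕ → List (Fin n) → Set
  Connected P ℓ A = ∀ {x y} → x ∈ˡ A → y ∈ˡ A → Walk G P x y ℓ

  connected-++ : ∀ {P k ℓ m A B} → Connected P k A → Connected P ℓ B → k ≤ m → ℓ ≤ m →
    (∀ {x y} → x ∈ˡ A → y ∈ˡ B → Walk G P x y m) → (∀ {x y} → x ∈ˡ B → y ∈ˡ A → Walk G P x y m) →
    Connected P m (A ++ B)
  connected-++ {A = A} cA cB k≤ ℓ≤ cAB cBA x∈ y∈ with ∈-++⁻ A x∈ | ∈-++⁻ A y∈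
  ... | inj₁ p | inj₁ q = relax G id k≤ (cA p q)
  ... | inj₁ p | inj₂ q = cAB p q
  ... | inj₂ p | inj₁ q = cBA p q
  ... | inj₂ p | inj₂ q = relax G id ℓ≤ (cB p q)

  connected-by-edge : ∀ {P k ℓ A B a b} → Connected P k A → Connected P ℓ B →
    a ∈ˡ A → b ∈ˡ B → Adj G a b → Connected P (suc (k + ℓ)) (A ++ B)
  connected-by-edge {k = k} {ℓ} cA cB a∈ b∈ e =
    connected-++ cA cB (m≤n⇒m≤1+n (m≤m+n k ℓ)) (m≤n⇒m≤1+n (m≤n+m ℓ k))
    (λ x∈ y∈ → join G (cA x∈ a∈) e (cB b∈ y∈))
    (λ x∈ y∈ → relax G id (s≤s (≤-reflexive (+-comm ℓ k))) (join G (cB x∈ b∈) (adj-sym G e) (cA a∈ y∈)))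

  -- The linking vertex may lie outside both sets as long as it satisfies `P`; its two edges account
  -- for the summand 2.
  connected-by-vertex : ∀ {P k ℓ A B a b w} → Connected P k A → Connected P ℓ B →
    a ∈ˡ A → b ∈ˡ B → Adj G a w → Adj G b w → P w → Connected P (2 + (k + ℓ)) (A ++ B)
  connected-by-vertex {P} {k} {ℓ} {A} {B} {w = w} cA cB a∈ b∈ aw bw pw =
    connected-++ cA cB (m≤n⇒m≤1+n (m≤n⇒m≤1+n (m≤m+n k ℓ))) (m≤n⇒m≤1+n (m≤n⇒m≤1+n (m≤n+m ℓ k)))
      (λ x∈ y∈ → through (cA x∈ a∈) aw bw (cB b∈ y∈))
      (λ x∈ y∈ → relax G id (≤-reflexive (cong (2 +_) (+-comm ℓ k))) (through (cB x∈ b∈) bw aw (cA a∈ y∈)))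
    where
    through : ∀ {x a b y k ℓ} → Walk G P x a k → Adj G a w → Adj G b w → Walk G P b y ℓ →
              Walk G P x y (2 + (k + ℓ))
    through {k = k} {ℓ} p aw bw q =
      relax G id (≤-reflexive (cong suc (+-suc k ℓ))) (join G p aw (join G (stay G pw) (adj-sym G bw) q))

  -- C-avoiding walks may leave A: clusters linked through a common neighbour are not connected in
  -- themselves, but remain connected off any third cluster.
  record Loose (C A : List (Fin n)) (k : ℕ) : Set where
    field
      conn : Connected (_∉ˡ C) k A
      sep  : Separated A C

  open Loose

  separated⇒avoids : ∀ {A C} → Separated A C → ∀ {v} → v ∈ˡ A → v ∉ˡ C
  separated⇒avoids s v∈A v∈C = s v∈A (∈⇒∈Nb v∈C)

  common⇒adjacent : ∀ {A B w} → Separated A B → w ∈ Nb A → w ∈ Nb B →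
                    ∃ λ a → a ∈ˡ A × Adj G a w
  common⇒adjacent s w∈A w∈B with ∈Nb⁻ w∈A
  ... | inj₁ w∈ = contradiction w∈B (s w∈)
  ... | inj₂ r = r

  loose-link : ∀ {A B C k ℓ} → Loose C A k → Loose C B ℓ → Separated A B → Nonempty (Nb A ∩ Nb B) →
               Loose C (A ++ B) (2 + (k + ℓ))
  loose-link {A} {B} lA lB s (w , w∈) =
    let w∈A , w∈B = x∈p∩q⁻ (Nb A) (Nb B) w∈
        _ , a∈ , aw = common⇒adjacent s w∈A w∈B
        _ , b∈ , bw = common⇒adjacent (separated-sym s) w∈B w∈A
    in record
      { conn = connected-by-vertex (conn lA) (conn lB) a∈ b∈ aw bw
                 -- The linking vertex lies in `Nb A`, which by separation does not meet `C`.
                 (λ w∈C → separated-sym (sep lA) w∈C w∈A)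
      ; sep = separated-++ A (sep lA) (sep lB)
      }

  -- Overlaps limited by the girth.

  module _ {g} (acyclic : ∀ k → k < g → ¬ HasCycleOfLength G k) where

    -- Two shared neighbours `x` and `y` would close a cycle: at most `ℓ` edges inside `C`, at most
    -- `k` edges between vertices of `A` off `C`, and four edges at `x` and `y`.
    overlap≤1 : ∀ {A C k ℓ} → Loose C A k → Connected (_∈ˡ C) ℓ C → 4 + (k + ℓ) < g → ∣ Nb A ∩ Nb C ∣ ≤ 1
    overlap≤1 {A} {C} {k} {ℓ} lA cC lt = all-equal⇒∣p∣≤1 _ λ x∈ y∈ → equal (x∈p∩q⁻ _ _ x∈) (x∈p∩q⁻ _ _ y∈)
      where
      equal : ∀ {x y} → x ∈ Nb A × x ∈ Nb C → y ∈ Nb A × y ∈ Nb C → x ≡ y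
      equal {x} {y} (xA , xC) (yA , yC) with x ≟ y
      ... | yes eq = eq
      ... | no x≢y =
        let s = separated-sym (sep lA)
            _ , a∈ , ax = common⇒adjacent (sep lA) xA xC
            _ , b∈ , by = common⇒adjacent (sep lA) yA yC
            _ , c∈ , cx = common⇒adjacent s xC xA
            _ , d∈ , dy = common⇒adjacent s yC yA
            outer = join G (join G (stay G λ y∈ → s y∈ yA) (adj-sym G by) (conn lA b∈ a∈)) ax
                      (stay G λ x∈ → s x∈ xA)
        in no-short-cycle G acyclic (cC c∈ d∈) dy outer (adj-sym G cx) (inj₂ (x≢y ∘ ≡.sym))
             (≤-trans (≤-reflexive (cong suc (eq k ℓ))) lt)
        where
        eq : ∀ k ℓ → 2 + ℓ + suc (suc k + 0) ≡ 4 + (k + ℓ)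
        eq = solve-∀

    -- A shared vertex `x` other than `a` and `b` closes a cycle with the edge `ab`: of length at
    -- most `k + ℓ + 2` if `x` lies in `A` or `B`, and at most `k + ℓ + 3` if it lies outside and is
    -- adjacent to both.
    edge-overlap≤2 : ∀ {A B a b k ℓ} → Connected (_∈ˡ A) k A → Connected (_∈ˡ B) ℓ B → Disjoint A B →
      a ∈ˡ A → b ∈ˡ B → Adj G a b → 3 + (k + ℓ) < g → ∣ Nb A ∩ Nb B ∣ ≤ 2
    edge-overlap≤2 {A} {B} {a} {b} {k} {ℓ} cA cB dis a∈ b∈ ab lt =
      ≤-trans (p⊆q⇒∣p∣≤∣q∣ λ x∈ → common (x∈p∩q⁻ _ _ x∈)) (∣⁅a⁆∪⁅b⁆∣≤2 a b)
      where
      B∉A : ∀ {v} → v ∈ˡ B → v ∉ˡ A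
      B∉A v∈B v∈A = dis v∈A v∈B
      lt′ : 2 + k + ℓ < g
      lt′ = ≤-trans (n≤1+n _) lt
      common : ∀ {x} → x ∈ Nb A × x ∈ Nb B → x ∈ ⁅ a ⁆ ∪ ⁅ b ⁆
      common {x} (xA , xB) with x ≟ a | x ≟ b
      ... | yes refl | _ = x∈p∪q⁺ (inj₁ (x∈⁅x⁆ x))
      ... | _ | yes refl = x∈p∪q⁺ {p = ⁅ a ⁆} (inj₂ (x∈⁅x⁆ x))
      ... | no x≢a | no x≢b with mem? _≟_ x A | mem? _≟_ x B | ∈Nb⁻ xA | ∈Nb⁻ xB
      ...   | yes x∈A | _ | _ | inj₁ x∈B = contradiction x∈B (dis x∈A)
      ...   | yes x∈A | _ | _ | inj₂ (b′ , b′∈ , b′x) =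
        no-short-cycle G acyclic (cA x∈A a∈) ab (relax G B∉A ≤-refl (cB b∈ b′∈)) b′x (inj₁ x≢a) lt′
      ...   | no x∉A | _ | inj₁ x∈A | _ = contradiction x∈A x∉A
      ...   | no x∉A | yes x∈B | inj₂ (a′ , a′∈ , a′x) | _ =
        no-short-cycle G acyclic (cA a∈ a′∈) a′x (relax G B∉A ≤-refl (cB x∈B b∈)) (adj-sym G ab)
          (inj₂ x≢b) lt′
      ...   | no _ | no x∉B | _ | inj₁ x∈B = contradiction x∈B x∉B
      ...   | no x∉A | no _ | inj₂ (a′ , a′∈ , a′x) | inj₂ (b′ , b′∈ , b′x) =
        no-short-cycle G acyclic (cA a∈ a′∈) a′x
          (join G (stay G x∉A) (adj-sym G b′x) (relax G B∉A ≤-refl (cB b′∈ b∈))) (adj-sym G ab) (inj₂ x≢b)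
          (≤-trans (≤-reflexive (cong (3 +_) (+-suc k ℓ))) lt)

-- Rearranging lists and numerical bounds.

module _ {A : Set} where

  allPairs-resp-↭ : ∀ {R : Rel A 0ℓ} → Symmetric R → ∀ {xs ys} → xs ↭ ys → AllPairs R xs → AllPairs R ys
  allPairs-resp-↭ {R} sym p = PermSetoid.AllPairs-resp-↭ (≡.setoid A) sym
    ((λ { refl → id }) , (λ { refl → id })) (↭⇒↭ₛ p)

  any⇒front : ∀ {P : A → Set} {xs} → Any P xs → ∃₂ λ y ys → xs ↭ y ∷ ys × P y
  any⇒front p with find p
  ... | y , y∈ , py with ∈-∃++ y∈
  ...   | ys , zs , refl = y , ys ++ zs , shift y ys zs , py

  -- A failing pair is brought to the front so that those two clusters can be merged.
  all-pairs-or-front : ∀ {R : Rel A 0ℓ} → Decidable R → ∀ xs →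
    AllPairs R xs ⊎ ∃₂ λ x y → ∃ λ zs → xs ↭ x ∷ y ∷ zs × ¬ R x y
  all-pairs-or-front R? [] = inj₁ []
  all-pairs-or-front R? (x ∷ xs) with All.all? (R? x) xs | all-pairs-or-front R? xs
  ... | yes a | inj₁ as = inj₁ (a ∷ as)
  ... | yes _ | inj₂ (y , z , zs , p , ¬r) =
    inj₂ (y , z , x ∷ zs , ↭-trans (prep x p) (↭-trans (swap x y ↭-refl) (prep y (swap x z ↭-refl))) , ¬r)
  ... | no ¬a | _ with any⇒front (All.¬All⇒Any¬ (R? x) xs ¬a)
  ...   | y , ys , p , ¬r = inj₂ (x , y , ys , prep x p , ¬r)

  ∈⇒≤sum : ∀ (f : A → ℕ) {x xs} → x ∈ˡ xs → f x ≤ sum (map f xs)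
  ∈⇒≤sum f (here refl) = m≤m+n _ _
  ∈⇒≤sum f {xs = y ∷ _} (there x∈) = ≤-trans (∈⇒≤sum f x∈) (m≤n+m _ (f y))

-- The number of pairs among `m` things, m(m - 1)/2.
triangular : ℕ → ℕ
triangular zero = 0
triangular (suc m) = m + triangular m

-- mantel m = ⌊m²/4⌋
mantel : ℕ → ℕ
mantel zero = 0
mantel (suc zero) = 0
mantel (suc (suc m)) = mantel m + suc m

mantel-mono : ∀ m → mantel m ≤ mantel (suc m)
mantel-mono zero = z≤n
mantel-mono (suc zero) = z≤n
mantel-mono (suc (suc m)) = +-mono-≤ (mantel-mono m) (n≤1+n _)

-- Bookkeeping for splitting off two clusters at once: `a`, `b`, `ab` measure the neighbourhoods of
-- the two and of their union, `s` and `r` the sum and the union over the others, and `t` the union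
-- of all.
≤-join : ∀ a b ab s r e u t j → a + b ≤ ab + 1 → ab + r ≤ u + j → s ≤ r + e → u ≤ t →
         a + (b + s) ≤ t + (e + suc j)
≤-join a b ab s r e u t j h₁ h₂ h₃ h₄ = ≤-from (+-mono-≤ h₁ (+-mono-≤ h₂ (+-mono-≤ h₃ h₄)))
  (≤-reflexive (eq a b ab s r e u t j))
  where
  eq : ∀ a b ab s r e u t j → a + (b + s) + (ab + 1 + (u + j + (r + e + t))) ≡
                              t + (e + suc j) + (a + b + (ab + r + (s + u)))
  eq = solve-∀

≤-join₃ : ∀ a b c ab abc s r e u t j → a + b ≤ ab + 1 → ab + c ≤ abc + 1 → abc + r ≤ u + j →
          s ≤ r + e → u ≤ t → a + (b + (c + s)) ≤ t + (e + (2 + j))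
≤-join₃ a b c ab abc s r e u t j h₁ h₁′ h₂ h₃ h₄ =
  ≤-from (+-mono-≤ h₁ (+-mono-≤ h₁′ (+-mono-≤ h₂ (+-mono-≤ h₃ h₄))))
  (≤-reflexive (eq a b c ab abc s r e u t j))
  where
  eq : ∀ a b c ab abc s r e u t j →
    a + (b + (c + s)) + (ab + 1 + (abc + 1 + (u + j + (r + e + t)))) ≡
    t + (e + (2 + j)) + (a + b + (ab + c + (abc + r + (s + u))))
  eq = solve-∀

-- Clusters and families of clusters.

module _ {n} (G : Graph n) {g} (acyclic : ∀ k → k < g → ¬ HasCycleOfLength G k)
         {d} (d<deg : ∀ v → suc d ≤ deg G v) where

  -- For clusters built by `singleton` and `merge`, `suc diameter` is the number of vertices, so one
  -- number serves both as a bound on distances and in the count. In the application `d` is δ - 1.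
  record Cluster : Set where
    field
      verts     : List (Fin n)
      diameter  : ℕ
      connected : Connected G (_∈ˡ verts) diameter verts
      large     : d * suc diameter + 2 ≤ ∣ Nb G verts ∣

  open Cluster

  nbhd : Cluster → Subset n
  nbhd K = Nb G (verts K)

  diameters size ∑∣Nb∣ : List Cluster → ℕ
  diameters Ks = sum (map diameter Ks)
  size Ks = sum (map (suc ∘ diameter) Ks)
  ∑∣Nb∣ Ks = sum (map (∣_∣ ∘ nbhd) Ks)

  NbAll : List Cluster → Subset n
  NbAll Ks = ⋃ (map (nbhd) Ks)

  size≡ : ∀ Ks → size Ks ≡ diameters Ks + length Ks
  size≡ [] = refl
  size≡ (K ∷ Ks) = ≡.trans (cong (λ s → suc (diameter K + s)) (size≡ Ks))
    (eq (diameter K) (diameters Ks) (length Ks))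
    where
    eq : ∀ a b c → suc (a + (b + c)) ≡ a + b + suc c
    eq = solve-∀

  ∈NbAll⁺ : ∀ {x Ks} → Any (λ K → x ∈ nbhd K) Ks → x ∈ NbAll Ks
  ∈NbAll⁺ = ∈⋃⁺ ∘ Any.map⁺

  ∈NbAll⁻ : ∀ {x} Ks → x ∈ NbAll Ks → Any (λ K → x ∈ nbhd K) Ks
  ∈NbAll⁻ Ks = Any.map⁻ ∘ ∈⋃⁻ (map (nbhd) Ks)

  ∣NbAll∣-resp-↭ : ∀ {Ks Ls} → Ks ↭ Ls → ∣ NbAll Ks ∣ ≤ ∣ NbAll Ls ∣
  ∣NbAll∣-resp-↭ {Ks} p = p⊆q⇒∣p∣≤∣q∣ (∈NbAll⁺ ∘ Any-resp-↭ p ∘ ∈NbAll⁻ Ks)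

  ∣p∩NbAll∣≤length : ∀ p {Ks} → All (λ K → ∣ p ∩ nbhd K ∣ ≤ 1) Ks → ∣ p ∩ NbAll Ks ∣ ≤ length Ks
  ∣p∩NbAll∣≤length p {Ks} les =
    ≤-trans (∣p∩⋃∣≤length p (All.map⁺ les)) (≤-reflexive (length-map (nbhd) Ks))

  meets-or-disjoint : ∀ p Ks → (∃₂ λ L Ls → Ks ↭ L ∷ Ls × Nonempty (p ∩ nbhd L)) ⊎ Empty (p ∩ NbAll Ks)
  meets-or-disjoint p Ks with Any.any? (λ K → nonempty? (p ∩ nbhd K)) Ks
  ... | yes a = inj₁ (any⇒front a)
  ... | no ¬a = inj₂ λ (x , x∈) → let x∈p , x∈Ks = x∈p∩q⁻ p (NbAll Ks) x∈ in
    ¬a (Any.map (λ x∈K → x , x∈p∩q⁺ (x∈p , x∈K)) (∈NbAll⁻ Ks x∈Ks))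

  ∑∣Nb∣-large : ∀ Ks → d * size Ks + 2 * length Ks ≤ ∑∣Nb∣ Ks
  ∑∣Nb∣-large [] = ≤-reflexive (≡.trans (+-identityʳ (d * 0)) (*-zeroʳ d))
  ∑∣Nb∣-large (K ∷ Ks) = ≤-trans (≤-reflexive (eq d (diameter K) (size Ks) (length Ks)))
    (+-mono-≤ (large K) (∑∣Nb∣-large Ks))
    where
    eq : ∀ d k s l → d * (suc k + s) + 2 * suc l ≡ d * suc k + 2 + (d * s + 2 * l)
    eq = solve-∀

  -- c is the number of clusters of the original family: dropping clusters preserves the inequality.
  record Good (c : ℕ) (Ks : List Cluster) : Set where
    constructor good
    field
      separated : AllPairs (Separated G on verts) Ks
      small     : diameters Ks + c + 2 ≤ g

  good-resp-↭ : ∀ {c Ks Ls} → Ks ↭ Ls → Good c Ks → Good c Ls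
  good-resp-↭ {c} p (good s le) =
    good (allPairs-resp-↭ {R = Separated G on verts} (λ r → separated-sym G r) p s)
         (≤-trans (≤-reflexive (cong (λ m → m + c + 2) (≡.sym (sum-↭ (map⁺ diameter p))))) le)

  good-tail : ∀ {c K Ks} → Good c (K ∷ Ks) → Good c Ks
  good-tail {c} {K} {Ks} (good (_ ∷ s) le) =
    good s (≤-trans (+-monoˡ-≤ 2 (+-monoˡ-≤ c (m≤n+m (diameters Ks) (diameter K)))) le)

  good-weaken : ∀ {c c′ Ks} → c′ ≤ c → Good c Ks → Good c′ Ks
  good-weaken {Ks = Ks} c′≤c (good s le) = good s (≤-trans (+-monoˡ-≤ 2 (+-monoʳ-≤ (diameters Ks) c′≤c)) le)

  cluster-loose : ∀ K {C} → Separated G (verts K) C → Loose G C (verts K) (diameter K)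
  cluster-loose K s = record
    { conn = λ x∈ y∈ → relax G (separated⇒avoids G s) ≤-refl (connected K x∈ y∈)
    ; sep = s }

  -- Loss by overlaps in separated families.

  Bounded : List Cluster → ℕ → Set
  Bounded Ks e = ∑∣Nb∣ Ks ≤ ∣ NbAll Ks ∣ + e

  bounded-resp-↭ : ∀ {e Ks Ls} → Ks ↭ Ls → Bounded Ks e → Bounded Ls e
  bounded-resp-↭ {e} p b = ≤-trans (≤-reflexive (sum-↭ (map⁺ (∣_∣ ∘ nbhd) (↭-sym p))))
    (≤-trans b (+-monoˡ-≤ e (∣NbAll∣-resp-↭ p)))

  bounded-weaken : ∀ {e e′} Ks → e ≤ e′ → Bounded Ks e → Bounded Ks e′
  bounded-weaken Ks le b = ≤-trans b (+-monoʳ-≤ ∣ NbAll Ks ∣ le)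

  bounded-∷ : ∀ {j e} K Ks → ∣ nbhd K ∩ NbAll Ks ∣ ≤ j → Bounded Ks e → Bounded (K ∷ Ks) (j + e)
  bounded-∷ {j} {e} K Ks le b = ≤-from
    (+-mono-≤ (∣p∣+∣q∣≤∣p∪q∣+k (nbhd K) (NbAll Ks) le) b)
    (≤-reflexive (eq (∣ nbhd K ∣) (∑∣Nb∣ Ks) (∣ NbAll Ks ∣) (∣ NbAll (K ∷ Ks) ∣) j e))
    where
    eq : ∀ a s r u j e → a + s + (u + j + (r + e)) ≡ u + (j + e) + (a + r + s)
    eq = solve-∀

  bounded-∷∷ : ∀ {j e} A B Ks → ∣ nbhd A ∩ nbhd B ∣ ≤ 1 →
    ∣ Nb G (verts A ++ verts B) ∩ NbAll Ks ∣ ≤ j → Bounded Ks e → Bounded (A ∷ B ∷ Ks) (e + suc j)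
  bounded-∷∷ {j} {e} A B Ks le₁ le₂ b =
    ≤-join (∣ nbhd A ∣) (∣ nbhd B ∣) (∣ AB ∣) (∑∣Nb∣ Ks) (∣ NbAll Ks ∣) e
      (∣ AB ∪ NbAll Ks ∣) (∣ NbAll (A ∷ B ∷ Ks) ∣) j
      (∣Nb∣+∣Nb∣≤ G (verts A) (verts B) le₁) (∣p∣+∣q∣≤∣p∪q∣+k AB (NbAll Ks) le₂) b
      (p⊆q⇒∣p∣≤∣q∣ (∈NbAll⁺ {Ks = A ∷ B ∷ Ks} ∘
        [ [ here , there ∘ here ]′ ∘ Nb-++⁻ G (verts A) , there ∘ there ∘ ∈NbAll⁻ Ks ]′ ∘
        x∈p∪q⁻ AB (NbAll Ks)))
    where AB = Nb G (verts A ++ verts B)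

  cluster-overlap : ∀ {A k} K → Loose G (verts K) A k → 4 + (k + diameter K) < g →
                    ∣ Nb G A ∩ nbhd K ∣ ≤ 1
  cluster-overlap K l = overlap≤1 G acyclic l (connected K)

  -- With `c` = 3, a cycle through two clusters of diameters `k` and `l` sharing two neighbours
  -- would have length at most `k + l + 4`, less than `g`. Hence each pair of clusters costs at most
  -- one.
  triangular-bound : ∀ Ks → Good 3 Ks → Bounded Ks (triangular (length Ks))
  triangular-bound [] _ = z≤n
  triangular-bound (K ∷ Ks) gd@(good (sK ∷ _) le) =
    bounded-∷ K Ks (∣p∩NbAll∣≤length (nbhd K) (All.tabulate small-overlap))
      (triangular-bound Ks (good-tail gd))
    where
    eq : ∀ k l → k + l + 3 + 2 ≡ suc (4 + (k + l))
    eq = solve-∀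
    small-overlap : ∀ {L} → L ∈ˡ Ks → ∣ nbhd K ∩ nbhd L ∣ ≤ 1
    small-overlap {L} L∈ = cluster-overlap L (cluster-loose K (All.lookup sK L∈))
      (≤-trans (≤-reflexive (≡.sym (eq (diameter K) (diameter L))))
        (≤-trans (+-monoˡ-≤ 2 (+-monoˡ-≤ 3 (+-monoʳ-≤ (diameter K) (∈⇒≤sum diameter L∈)))) le))

  pair-overlap : ∀ {A B Ks} → Good 3 (A ∷ B ∷ Ks) → ∣ nbhd A ∩ nbhd B ∣ ≤ 1
  pair-overlap {A} {B} {Ks} (good ((sAB ∷ _) ∷ _) le) = cluster-overlap B (cluster-loose A sAB)
    (≤-trans (≤-trans (m≤m+n _ (diameters Ks))
      (≤-reflexive (eq (diameter A) (diameter B) (diameters Ks)))) le)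
    where
    eq : ∀ a b s → suc (4 + (a + b)) + s ≡ a + (b + s) + 3 + 2
    eq = solve-∀

  -- Off `K`, the linked clusters `A` and `B` act as one loose set of diameter a + b + 2, and the
  -- resulting cycle of length at most a + b + k + 6 is excluded by `c` = 5. This replaces
  -- triangle-freeness: all three may share one vertex, but `K` still meets `A` and `B` together
  -- only once.
  pair-overlaps : ∀ {A B Ks} → Good 5 (A ∷ B ∷ Ks) → Nonempty (nbhd A ∩ nbhd B) →
                  All (λ K → ∣ Nb G (verts A ++ verts B) ∩ nbhd K ∣ ≤ 1) Ks
  pair-overlaps {A} {B} {Ks} (good ((sAB ∷ sA) ∷ sB ∷ _) le) ne = All.tabulate λ {K} K∈ →
    cluster-overlap K
      (loose-link G (cluster-loose A (All.lookup sA K∈)) (cluster-loose B (All.lookup sB K∈)) sAB ne)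
      (≤-trans (≤-reflexive (eq (diameter A) (diameter B) (diameter K)))
        (≤-trans (+-monoˡ-≤ 2 (+-monoˡ-≤ 5 (+-monoʳ-≤ (diameter A)
          (+-monoʳ-≤ (diameter B) (∈⇒≤sum diameter K∈))))) le))
    where
    eq : ∀ a b k → suc (4 + (2 + (a + b) + k)) ≡ a + (b + k) + 5 + 2
    eq = solve-∀

  -- Mantel's induction: a cluster that shares nothing is removed at no cost. Otherwise a sharing
  -- pair is removed, costing one for the pair and at most one for each of the `m` others.
  mantel-step : ∀ m K Ks → length Ks ≡ suc m → Good 5 (K ∷ Ks) →
    (∀ Ls → length Ls ≡ suc m → Good 5 Ls → Bounded Ls (mantel (suc m))) →
    (∀ Ls → length Ls ≡ m → Good 5 Ls → Bounded Ls (mantel m)) →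
    Bounded (K ∷ Ks) (mantel (2 + m))
  mantel-step m A Ks len gd ih₁ ih₂ with meets-or-disjoint (nbhd A) Ks
  ... | inj₂ e = bounded-weaken (A ∷ Ks) (mantel-mono (suc m))
    (bounded-∷ A Ks (Empty⇒∣p∣≤0 e) (ih₁ Ks len (good-tail gd)))
  ... | inj₁ (B , Ls , p , ne) = bounded-resp-↭ (prep A (↭-sym p))
    (bounded-∷∷ A B Ls (pair-overlap (good-weaken (m≤n+m 3 2) gd′))
      (≤-trans (∣p∩NbAll∣≤length (Nb G (verts A ++ verts B)) (pair-overlaps gd′ ne)) (≤-reflexive len′))
      (ih₂ Ls len′ (good-tail (good-tail gd′))))
    where
    gd′ : Good 5 (A ∷ B ∷ Ls)
    gd′ = good-resp-↭ (prep A p) gd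
    len′ : length Ls ≡ m
    len′ = suc-injective (≡.trans (≡.sym (↭-length p)) len)

  mantel-bound : ∀ m Ks → length Ks ≡ m → Good 5 Ks → Bounded Ks (mantel m)
  mantel-bound zero [] refl _ = z≤n
  mantel-bound (suc zero) (K ∷ []) refl gd =
    triangular-bound (K ∷ []) (good-weaken {Ks = K ∷ []} (m≤n+m 3 2) gd)
  mantel-bound (suc (suc m)) (K ∷ Ks) len gd =
    mantel-step m K Ks (suc-injective len) gd (mantel-bound (suc m)) (mantel-bound m)

  -- The same with a linked path of three clusters, of loose diameter a + b + c + 4; this stands in
  -- for the absence of 4-cycles.
  triple-overlaps : ∀ {A B C Ks} → Good 8 (A ∷ B ∷ C ∷ Ks) → Nonempty (nbhd A ∩ nbhd B) →
    Nonempty (Nb G (verts A ++ verts B) ∩ nbhd C) →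
    All (λ K → ∣ Nb G ((verts A ++ verts B) ++ verts C) ∩ nbhd K ∣ ≤ 1) Ks
  triple-overlaps {A} {B} {C} {Ks} (good ((sAB ∷ sAC ∷ sA) ∷ (sBC ∷ sB) ∷ sC ∷ _) le) ne ne′ =
    All.tabulate λ {K} K∈ → cluster-overlap K
      (loose-link G
        (loose-link G (cluster-loose A (All.lookup sA K∈)) (cluster-loose B (All.lookup sB K∈)) sAB ne)
        (cluster-loose C (All.lookup sC K∈)) (separated-++ G (verts A) sAC sBC) ne′)
      (≤-trans (≤-trans (n≤1+n _)
        (≤-reflexive (eq (diameter A) (diameter B) (diameter C) (diameter K))))
        (≤-trans (+-monoˡ-≤ 2 (+-monoˡ-≤ 8 (+-monoʳ-≤ (diameter A) (+-monoʳ-≤ (diameter B)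
          (+-monoʳ-≤ (diameter C) (∈⇒≤sum diameter K∈)))))) le))
    where
    eq : ∀ a b c k → suc (suc (4 + (2 + (2 + (a + b) + c) + k))) ≡ a + (b + (c + k)) + 8 + 2
    eq = solve-∀

  triple-step : ∀ {e A B C Ks} → Good 8 (A ∷ B ∷ C ∷ Ks) → Nonempty (nbhd A ∩ nbhd B) →
    Nonempty (Nb G (verts A ++ verts B) ∩ nbhd C) → Bounded Ks e →
    Bounded (A ∷ B ∷ C ∷ Ks) (e + (2 + length Ks))
  triple-step {e} {A} {B} {C} {Ks} gd ne ne′ b =
    ≤-join₃ (∣ nbhd A ∣) (∣ nbhd B ∣) (∣ nbhd C ∣) (∣ Nb G AB ∣) (∣ Nb G ABC ∣) (∑∣Nb∣ Ks) (∣ NbAll Ks ∣) e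
      (∣ Nb G ABC ∪ NbAll Ks ∣) (∣ NbAll (A ∷ B ∷ C ∷ Ks) ∣) (length Ks)
      (∣Nb∣+∣Nb∣≤ G (verts A) (verts B) (pair-overlap (good-weaken (m≤n+m 3 5) gd)))
      (∣Nb∣+∣Nb∣≤ G AB (verts C)
        (All.head (pair-overlaps (good-weaken (m≤n+m 5 3) gd) ne)))
      (∣p∣+∣q∣≤∣p∪q∣+k (Nb G ABC) (NbAll Ks) (∣p∩NbAll∣≤length (Nb G ABC) (triple-overlaps gd ne ne′)))
      b
      (p⊆q⇒∣p∣≤∣q∣ (∈NbAll⁺ {Ks = A ∷ B ∷ C ∷ Ks} ∘
        [ [ [ here , there ∘ here ]′ ∘ Nb-++⁻ G (verts A) , there ∘ there ∘ here ]′ ∘ Nb-++⁻ G AB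
        , there ∘ there ∘ there ∘ ∈NbAll⁻ Ks ]′ ∘ x∈p∪q⁻ (Nb G ABC) (NbAll Ks)))
    where
    AB = verts A ++ verts B
    ABC = AB ++ verts C

  -- Mantel alone would give 16. Instead, the loss is at most 12 if `A` shares nothing, 1 + 9 if a
  -- pair shares nothing with the rest, and 6 + 2 + 5 if a linked triple is removed.
  eight-bound : ∀ Ks → length Ks ≡ 8 → Good 8 Ks → Bounded Ks 14
  eight-bound (A ∷ Ks) len gd with meets-or-disjoint (nbhd A) Ks
  ... | inj₂ e = bounded-weaken (A ∷ Ks) (m≤n+m 12 2)
    (bounded-∷ A Ks (Empty⇒∣p∣≤0 e)
      (mantel-bound 7 Ks (suc-injective len) (good-tail (good-weaken (m≤n+m 5 3) gd))))
  ... | inj₁ (B , Ls , p , ne) with meets-or-disjoint (Nb G (verts A ++ verts B)) Ls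
  ...   | inj₂ e = bounded-resp-↭ (prep A (↭-sym p)) (bounded-weaken (A ∷ B ∷ Ls) (m≤n+m 10 4)
    (bounded-∷∷ A B Ls (pair-overlap (good-weaken (m≤n+m 3 5) gd′)) (Empty⇒∣p∣≤0 e)
      (mantel-bound 6 Ls len′ (good-tail (good-tail (good-weaken (m≤n+m 5 3) gd′))))))
    where
    gd′ : Good 8 (A ∷ B ∷ Ls)
    gd′ = good-resp-↭ (prep A p) gd
    len′ : length Ls ≡ 6
    len′ = suc-injective (≡.trans (≡.sym (↭-length p)) (suc-injective len))
  ...   | inj₁ (C , Ms , q , ne′) = bounded-resp-↭ (↭-trans (prep A (prep B (↭-sym q))) (prep A (↭-sym p)))
    (bounded-weaken (A ∷ B ∷ C ∷ Ms) (≤-trans (≤-reflexive (cong (8 +_) len′)) (m≤n+m 13 1))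
      (triple-step gd′ ne ne′
        (mantel-bound 5 Ms len′ (good-tail (good-tail (good-tail (good-weaken (m≤n+m 5 3) gd′)))))))
    where
    gd′ : Good 8 (A ∷ B ∷ C ∷ Ms)
    gd′ = good-resp-↭ (↭-trans (prep A p) (prep A (prep B q))) gd
    len′ : length Ms ≡ 5
    len′ = suc-injective (≡.trans (≡.sym (↭-length q))
      (suc-injective (≡.trans (≡.sym (↭-length p)) (suc-injective len))))

  separated-bound : ∀ m Ks → length Ks ≡ 3 + m → m ≤ 5 → AllPairs (Separated G on verts) Ks →
                    size Ks + 2 ≤ g → ∃ λ e → Bounded Ks e × 2 + e ≤ 2 * (3 + m)
  separated-bound m Ks len m≤5 sep le = by-count m len m≤5
    where
    -- `size` exceeds `diameters` by the number of clusters, which therefore becomes `c`.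
    gd : ∀ {m} → length Ks ≡ m → Good m Ks
    gd refl = good sep (≤-trans (+-monoˡ-≤ 2 (≤-reflexive (≡.sym (size≡ Ks)))) le)
    by-count : ∀ m → length Ks ≡ 3 + m → m ≤ 5 → ∃ λ e → Bounded Ks e × 2 + e ≤ 2 * (3 + m)
    -- The allowances 2(3 + m - 1) are 4, 6, 8, 10, 12, 14. With three or four clusters counting
    -- pairs suffices; from five on `c` is large enough for Mantel.
    by-count 0 eq _ = 3 , subst (Bounded Ks ∘ triangular) eq (triangular-bound Ks (gd eq)) , m≤n+m 5 1
    by-count 1 eq _ =
      6 , subst (Bounded Ks ∘ triangular) eq (triangular-bound Ks (good-weaken (m≤n+m 3 1) (gd eq))) , ≤-refl
    by-count 2 eq _ = 6 , mantel-bound 5 Ks eq (gd eq) , m≤n+m 8 2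
    by-count 3 eq _ = 9 , mantel-bound 6 Ks eq (good-weaken (m≤n+m 5 1) (gd eq)) , m≤n+m 11 1
    by-count 4 eq _ = 12 , mantel-bound 7 Ks eq (good-weaken (m≤n+m 5 2) (gd eq)) , ≤-refl
    by-count 5 eq _ = 14 , eight-bound Ks eq (gd eq) , ≤-refl
    by-count (suc (suc (suc (suc (suc (suc _)))))) _ (s≤s (s≤s (s≤s (s≤s (s≤s ())))))

  -- Merging adjacent clusters.

  merge : ∀ A B {a b} → Disjoint G (verts A) (verts B) → a ∈ˡ verts A → b ∈ˡ verts B → Adj G a b →
          4 + (diameter A + diameter B) ≤ g → Cluster
  merge A B dis a∈ b∈ ab le = record
    { verts = verts A ++ verts B
    ; diameter = suc (diameter A + diameter B)
    ; connected = connected-by-edge G (λ x∈ y∈ → relax G ∈-++⁺ˡ ≤-refl (connected A x∈ y∈))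
        (λ x∈ y∈ → relax G (∈-++⁺ʳ (verts A)) ≤-refl (connected B x∈ y∈)) a∈ b∈ ab
    -- Each cluster brings a surplus of 2 and the overlap costs at most 2, so a surplus of 2
    -- survives.
    ; large = +-cancelʳ-≤ 2 _ _ (≤-trans (≤-trans (≤-reflexive (eq d (diameter A) (diameter B)))
        (+-mono-≤ (large A) (large B)))
        (∣Nb∣+∣Nb∣≤ G (verts A) (verts B)
          (edge-overlap≤2 G acyclic (connected A) (connected B) dis a∈ b∈ ab le)))
    }
    where
    eq : ∀ d a b → d * suc (suc (a + b)) + 2 + 2 ≡ d * suc a + 2 + (d * suc b + 2)
    eq = solve-∀

  LargeUnion : List Cluster → Set
  LargeUnion Ks = d * size Ks + 2 ≤ ∣ NbAll Ks ∣

  -- The clusters bring a surplus of 2 each; after the loss `e` at least 2 remains.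
  bounded⇒large-union : ∀ {e} Ks → Bounded Ks e → 2 + e ≤ 2 * length Ks → LargeUnion Ks
  bounded⇒large-union {e} Ks b e≤ = ≤-from (+-mono-≤ (≤-trans (∑∣Nb∣-large Ks) b) e≤)
    (≤-reflexive (eq (d * size Ks) (∣ NbAll Ks ∣) e (2 * length Ks)))
    where
    eq : ∀ a u e l → a + 2 + (u + e + l) ≡ u + (a + l + (2 + e))
    eq = solve-∀

  large-union-resp-↭ : ∀ {Ks Ls} → Ks ↭ Ls → LargeUnion Ks → LargeUnion Ls
  large-union-resp-↭ p l = ≤-trans
    (≤-reflexive (cong (λ s → d * s + 2) (sum-↭ (map⁺ (suc ∘ diameter) (↭-sym p)))))
    (≤-trans l (∣NbAll∣-resp-↭ p))

  -- Merging changes neither the total size nor the union of the neighbourhoods, so the bound can be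
  -- proved after the merge.
  large-union-unmerge : ∀ {A B M} Ks → verts M ≡ verts A ++ verts B →
    diameter M ≡ suc (diameter A + diameter B) → LargeUnion (M ∷ Ks) → LargeUnion (A ∷ B ∷ Ks)
  large-union-unmerge {A} {B} {M} Ks vM dM l =
    ≤-trans (≤-reflexive (cong (λ s → d * s + 2) sizes)) (≤-trans l
    (p⊆q⇒∣p∣≤∣q∣ λ x∈ → ∈NbAll⁺ {Ks = A ∷ B ∷ Ks} (unmerge (∈NbAll⁻ (M ∷ Ks) x∈))))
    where
    sizes : size (A ∷ B ∷ Ks) ≡ size (M ∷ Ks)
    sizes = ≡.trans (eq (diameter A) (diameter B) (size Ks)) (cong (λ k → suc k + size Ks) (≡.sym dM))
      where
      eq : ∀ a b s → suc a + (suc b + s) ≡ suc (suc (a + b)) + s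
      eq = solve-∀
    unmerge : ∀ {x} → Any (λ K → x ∈ nbhd K) (M ∷ Ks) → Any (λ K → x ∈ nbhd K) (A ∷ B ∷ Ks)
    unmerge {x} (here x∈) = [ here , there ∘ here ]′ (Nb-++⁻ G (verts A) (subst (λ V → x ∈ Nb G V) vM x∈))
    unmerge (there x∈) = there (there x∈)

  -- After the merge of A and B only two clusters are left, and these may share two neighbours:
  -- at most one with A and one with B.
  large-union-adjacent-three : ∀ A B C {a b} →
    Disjoint G (verts A) (verts B) → Disjoint G (verts A) (verts C) → Disjoint G (verts B) (verts C) →
    a ∈ˡ verts A → b ∈ˡ verts B → Adj G a b →
    size (A ∷ B ∷ C ∷ []) + 2 ≤ g → LargeUnion (A ∷ B ∷ C ∷ [])
  large-union-adjacent-three A B C dAB dAC dBC a∈ b∈ ab le =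
    large-union-unmerge {A} {B} {M} (C ∷ []) refl refl MC-large
    where
    dA = diameter A
    dB = diameter B
    dC = diameter C
    le′ : 5 + (dA + dB + dC) ≤ g
    le′ = ≤-trans (≤-reflexive (eq dA dB dC)) le
      where
      eq : ∀ a b c → 5 + (a + b + c) ≡ suc a + (suc b + (suc c + 0)) + 2
      eq = solve-∀
    M : Cluster
    M = merge A B dAB a∈ b∈ ab (≤-trans (+-mono-≤ (n≤1+n 4) (m≤m+n (dA + dB) dC)) le′)
    dMC : Disjoint G (verts M) (verts C)
    dMC x∈ = [ (λ p → dAC p) , (λ p → dBC p) ]′ (∈-++⁻ (verts A) x∈)
    overlap-C : ∀ K → Separated G (verts K) (verts C) → diameter K ≤ dA + dB →
                ∣ nbhd K ∩ NbAll (C ∷ []) ∣ ≤ 1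
    overlap-C K s k≤ = ∣p∩NbAll∣≤length (nbhd K) {C ∷ []}
      (cluster-overlap C (cluster-loose K s) (≤-trans (+-monoʳ-≤ 5 (+-monoˡ-≤ dC k≤)) le′) ∷ [])
    MC-large : LargeUnion (M ∷ C ∷ [])
    MC-large with separated? G (verts M) (verts C)
    -- A second merge leaves one cluster, whose field `large` is the claim; `le′` is exactly the
    -- room this merge needs.
    ... | no ¬sep =
      let c , c′ , c∈ , c′∈ , e = ¬separated⇒edge G dMC ¬sep
          M′ = merge M C dMC c∈ c′∈ e le′
      in large-union-unmerge {M} {C} {M′} [] refl refl (≤-trans
           (≤-reflexive (cong (λ s → d * s + 2) (+-identityʳ (suc (diameter M′)))))
           (≤-trans (large M′) (∣p∣≤∣p∪q∣ (nbhd M′) ⊥)))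
    ... | yes sep = bounded⇒large-union (M ∷ C ∷ [])
      (bounded-∷ M (C ∷ []) (≤-trans
          (p⊆q⇒∣p∣≤∣q∣ λ x∈ → let x∈M , x∈C = x∈p∩q⁻ (nbhd M) (NbAll (C ∷ [])) x∈ in x∈p∪q⁺
             (Sum.map (λ p → x∈p∩q⁺ (p , x∈C)) (λ p → x∈p∩q⁺ (p , x∈C)) (Nb-++⁻ G (verts A) x∈M)))
          (≤-trans (∣p∪q∣≤∣p∣+∣q∣ (nbhd A ∩ NbAll (C ∷ [])) (nbhd B ∩ NbAll (C ∷ [])))
            (+-mono-≤ (overlap-C A (λ x∈ → sep (∈-++⁺ˡ x∈)) (m≤m+n dA dB))
                      (overlap-C B (λ x∈ → sep (∈-++⁺ʳ (verts A) x∈)) (m≤n+m dB dA)))))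
        (bounded-∷ C [] (∣p∩NbAll∣≤length (nbhd C) []) z≤n))
      ≤-refl

  -- The induction hypothesis `ih` needs at least three clusters after the merge, so three clusters
  -- before it form the base case.
  large-union-adjacent : ∀ m A B Ks {a b} → length Ks ≡ 1 + m →
    AllPairs (Disjoint G on verts) (A ∷ B ∷ Ks) →
    a ∈ˡ verts A → b ∈ˡ verts B → Adj G a b → size (A ∷ B ∷ Ks) + 2 ≤ g →
    (∀ k → m ≡ suc k → ∀ Ls → length Ls ≡ 3 + k → AllPairs (Disjoint G on verts) Ls →
      size Ls + 2 ≤ g → LargeUnion Ls) →
    LargeUnion (A ∷ B ∷ Ks)
  large-union-adjacent zero A B (C ∷ []) _ ((dAB ∷ dAC ∷ []) ∷ (dBC ∷ []) ∷ _) a∈ b∈ ab le _ =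
    large-union-adjacent-three A B C dAB dAC dBC a∈ b∈ ab le
  large-union-adjacent (suc m) A B Ks len ((dAB ∷ dA) ∷ dB ∷ dis) a∈ b∈ ab le ih =
    large-union-unmerge {A} {B} {M} Ks refl refl (ih m refl (M ∷ Ks) (cong suc len)
      (All.tabulate (λ {K} K∈ {x} x∈ →
        [ (λ p → All.lookup dA K∈ p) , (λ p → All.lookup dB K∈ p) ]′ (∈-++⁻ (verts A) x∈)) ∷ dis)
      (≤-trans (≤-reflexive (≡.sym (eq (diameter A) (diameter B) (size Ks)))) le))
    where
    eq : ∀ a b s → suc a + (suc b + s) + 2 ≡ suc (suc (a + b)) + s + 2
    eq = solve-∀
    eq′ : ∀ a b s → suc a + (suc b + s) + 2 ≡ 4 + (a + b) + s
    eq′ = solve-∀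
    M : Cluster
    M = merge A B dAB a∈ b∈ ab (≤-trans (m≤m+n _ (size Ks))
      (≤-trans (≤-reflexive (≡.sym (eq′ (diameter A) (diameter B) (size Ks)))) le))

  -- Induction on the number of clusters, ending early once they are pairwise separated. The girth
  -- condition persists because merging preserves `size`.
  large-union : ∀ m Ks → length Ks ≡ 3 + m → m ≤ 5 → AllPairs (Disjoint G on verts) Ks → size Ks + 2 ≤ g →
                LargeUnion Ks
  large-union m Ks len m≤5 dis le
    with all-pairs-or-front {R = Separated G on verts} (λ K L → separated? G (verts K) (verts L)) Ks
  ... | inj₁ sep = let e , b , e≤ = separated-bound m Ks len m≤5 sep le in
    bounded⇒large-union Ks b (≤-trans e≤ (≤-reflexive (cong (2 *_) (≡.sym len))))
  ... | inj₂ (A , B , Ls , p , ¬sep) =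
    large-union-resp-↭ (↭-sym p) (large-union-adjacent m A B Ls
      (suc-injective (suc-injective (≡.trans (≡.sym (↭-length p)) len))) dis′
      (proj₁ edge) (proj₁ (proj₂ edge)) (proj₂ (proj₂ edge))
      (≤-trans (≤-reflexive (cong (_+ 2) (sum-↭ (map⁺ (suc ∘ diameter) (↭-sym p))))) le)
      (λ { k refl Ms len″ dis″ le″ → large-union k Ms len″ (≤-trans (n≤1+n k) m≤5) dis″ le″ }))
    where
    dis′ : AllPairs (Disjoint G on verts) (A ∷ B ∷ Ls)
    dis′ = allPairs-resp-↭ {R = Disjoint G on verts} (λ r x∈ x∈′ → r x∈′ x∈) p dis
    edge = proj₂ (proj₂ (¬separated⇒edge G (All.head (AllPairs.head dis′)) ¬sep))

  singleton : Fin n → Cluster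
  singleton v = record
    { verts = v ∷ []
    ; diameter = 0
    ; connected = λ { (here refl) (here refl) → stay G (here refl) }
    ; large = ≤-trans (≤-reflexive (eq d)) (≤-trans (+-mono-≤ (≤-reflexive (≡.sym (∣⁅x⁆∣≡1 v))) (d<deg v))
        (≤-trans (∣p∣+∣q∣≤∣p∪q∣+k ⁅ v ⁆ (N G v) (Empty⇒∣p∣≤0 irreflexive))
          (≤-trans (≤-reflexive (+-identityʳ _)) (p⊆q⇒∣p∣≤∣q∣ λ x∈ →
            [ (λ x∈v → subst (_∈ Nb G (v ∷ [])) (≡.sym (x∈⁅y⁆⇒x≡y v x∈v)) (∈⇒∈Nb G (here refl)))
            , (λ x∈N → Adj⇒∈Nb G (here refl) (∈N⇒Adj G x∈N)) ]′ (x∈p∪q⁻ ⁅ v ⁆ (N G v) x∈)))))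
    }
    where
    eq : ∀ d → d * 1 + 2 ≡ 1 + suc d
    eq = solve-∀
    irreflexive : Empty (⁅ v ⁆ ∩ N G v)
    irreflexive (x , x∈) with x∈p∩q⁻ ⁅ v ⁆ (N G v) x∈
    ... | x∈v , x∈N with x∈⁅y⁆⇒x≡y v x∈v
    ...   | refl with ≡.trans (≡.sym (∈N⇒Adj G x∈N)) (Graph.irrefl G v)
    ...     | ()

  large-Nb : ∀ m U → length U ≡ 3 + m → m ≤ 5 → Unique U → length U + 2 ≤ g → d * length U + 2 ≤ ∣ Nb G U ∣
  large-Nb m U len m≤5 u le = ≤-trans (≤-reflexive (cong (λ s → d * s + 2) (≡.sym (size-singletons U))))
    (≤-trans (large-union m (map singleton U) (≡.trans (length-map singleton U) len) m≤5
       (AllPairs.map⁺ (AllPairs.map (λ { x≢y (here refl) (here refl) → x≢y refl }) u))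
       (≤-trans (≤-reflexive (cong (_+ 2) (size-singletons U))) le))
     (p⊆q⇒∣p∣≤∣q∣ λ x∈ → let v , v∈ , x∈v = find (Any.map⁻ (∈NbAll⁻ (map singleton U) x∈)) in widen v∈ x∈v))
    where
    size-singletons : ∀ V → size (map singleton V) ≡ length V
    size-singletons [] = refl
    size-singletons (_ ∷ V) = cong suc (size-singletons V)
    widen : ∀ {v x} → v ∈ˡ U → x ∈ Nb G (v ∷ []) → x ∈ Nb G U
    widen v∈ x∈ with ∈Nb⁻ G x∈
    ... | inj₁ (here refl) = ∈⇒∈Nb G v∈
    ... | inj₂ (_ , here refl , e) = Adj⇒∈Nb G v∈ e

-- Collecting forcers from the forcing process.

module _ {n} (G : Graph n) where

  -- In the application `c` is a shortest cycle, whose `g` distinct vertices guarantee that padding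
  -- never runs out.
  fresh : ∀ {g} {c : Fin g → Fin n} → (∀ {i j} → c i ≡ c j → i ≡ j) → (U : List (Fin n)) → length U < g →
          ∃ λ v → v ∉ˡ U
  fresh {c = c} inj U U<g with any? (λ i → ¬? (mem? _≟_ (c i) U))
  ... | yes (i , ci∉) = c i , ci∉
  ... | no ¬∃ = contradiction
      (injective⇒≤ (λ {i} {j} eq → inj (position-injective (c∈ i) (c∈ j) eq))) (<⇒≱ U<g)
    where
    c∈ : ∀ i → c i ∈ˡ U
    c∈ i = decidable-stable (mem? _≟_ (c i) U) λ ∉ → ¬∃ (i , ∉)
    position-injective : ∀ {x y : Fin n} {xs} (p : x ∈ˡ xs) (q : y ∈ˡ xs) → index p ≡ index q → x ≡ y
    position-injective {xs = xs} p q eq =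
      ≡.trans (Any.lookup-index p) (≡.trans (cong (lookup xs) eq) (≡.sym (Any.lookup-index q)))

  extend : ∀ {g} {c : Fin g → Fin n} → (∀ {i j} → c i ≡ c j → i ≡ j) → ∀ k U → Unique U → length U + k ≤ g →
           ∃ λ (V : List (Fin n)) → Unique V × length V ≡ length U + k
  extend inj zero U u _ = U , u , ≡.sym (+-identityʳ _)
  extend inj (suc k) U u le
    with fresh inj U (≤-trans (s≤s (m≤m+n (length U) k)) (≤-trans (≤-reflexive (≡.sym (+-suc _ k))) le))
  ... | v , v∉ =
    let V , uV , len = extend inj k (v ∷ U) (All.¬Any⇒All¬ U v∉ ∷ u)
                        (≤-trans (≤-reflexive (≡.sym (+-suc _ k))) le)
    in V , uV , ≡.trans len (≡.sym (+-suc _ k))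

  -- Invariant: `U` lists the forcers so far, their closed neighbourhoods are coloured, and `C` has
  -- grown by at most one vertex per forcer. `k` counts the vertices still to be collected.
  forcers : ∀ {g} {c : Fin g → Fin n} → (∀ {i j} → c i ≡ c j → i ≡ j) →
    ∀ {C s} k U → Unique U → Nb G U ⊆ C → ∣ C ∣ ≤ s + length U → length U + k ≤ g → Reaches G C ⊤ →
    ∃ λ (V : List (Fin n)) → Unique V × length V ≡ length U + k × ∣ Nb G V ∣ ≤ s + (length U + k)
  forcers inj {s = s} zero U u U⊆ C≤ _ _ = U , u , ≡.sym (+-identityʳ _) ,
    ≤-trans (p⊆q⇒∣p∣≤∣q∣ U⊆) (≤-trans C≤ (≤-reflexive (cong (s +_) (≡.sym (+-identityʳ (length U))))))
  -- Everything is coloured already, so any padding keeps its neighbourhood within the bound on `C`.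
  forcers inj {s = s} (suc k) U u U⊆ C≤ le done =
    let V , uV , len = extend inj (suc k) U u le
    in V , uV , len , ≤-trans (p⊆q⇒∣p∣≤∣q∣ {p = Nb G V} {q = ⊤} (λ _ → ∈⊤))
         (≤-trans C≤ (+-monoʳ-≤ s (m≤m+n (length U) (suc k))))
  forcers inj {C} {s} (suc k) U u U⊆ C≤ le (step (v , w , v∈C , vw , w∉C , only , refl) r) =
    let V , uV , len , V≤ = forcers inj {s = s} k (v ∷ U) (All.¬Any⇒All¬ U v∉U ∷ u) vU⊆
          (≤-trans (∣p∪q∣≤∣p∣+∣q∣ C ⁅ w ⁆) (≤-trans (+-mono-≤ C≤ (≤-reflexive (∣⁅x⁆∣≡1 w)))
            (≤-reflexive (eq s (length U)))))
          (≤-trans (≤-reflexive (≡.sym (+-suc _ k))) le) r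
    in V , uV , ≡.trans len (≡.sym (+-suc _ k)) , ≤-trans V≤ (≤-reflexive (cong (s +_) (≡.sym (+-suc _ k))))
    where
    eq : ∀ s l → s + l + 1 ≡ s + suc l
    eq = solve-∀
    v∉U : v ∉ˡ U
    -- An earlier forcer has no uncoloured neighbour left, so no vertex forces twice.
    v∉U v∈U = w∉C (U⊆ (Adj⇒∈Nb G v∈U vw))
    vU⊆ : Nb G (v ∷ U) ⊆ C ∪ ⁅ w ⁆
    vU⊆ {x} x∈ with ∈Nb⁻ G x∈
    ... | inj₁ (here refl) = x∈p∪q⁺ (inj₁ v∈C)
    ... | inj₁ (there x∈U) = x∈p∪q⁺ (inj₁ (U⊆ (∈⇒∈Nb G x∈U)))
    ... | inj₂ (_ , there y∈U , yx) = x∈p∪q⁺ (inj₁ (U⊆ (Adj⇒∈Nb G y∈U yx)))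
    ... | inj₂ (_ , here refl , vx) with x ∈? C
    ...   | yes x∈C = x∈p∪q⁺ (inj₁ x∈C)
    ...   | no x∉C = x∈p∪q⁺ {p = C} (inj₂ (subst (_∈ ⁅ w ⁆) (≡.sym (only x vx x∉C)) (x∈⁅x⁆ w)))

theorem3 : ∀ {n} (G : Graph n) (g δ f : ℕ) →
    IsGirth G g → 7 ≤ g → g ≤ 10 →
    IsMinDegree G δ → 2 ≤ δ →
    IsForcingNumber G f →
    δ + (δ ∸ 2) * (g ∸ 3) ≤ f
theorem3 {n} G (suc (suc (suc (suc (suc m))))) (suc (suc k)) _ ((_ , c , inj , _) , acyclic)
  (s≤s (s≤s (s≤s (s≤s (s≤s _))))) g≤10 (δ≤deg , _) (s≤s (s≤s _)) ((S , forcing , refl) , _) =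
  -- Here `g` is 5 + m and δ is 2 + k, so 3 + m is g - 2 and `suc k` is δ - 1.
  let U , u , len , U≤ = forcers G inj {s = ∣ S ∣} (3 + m) [] [] (⊥-elim ∘ ∉Nb[])
                           (m≤m+n _ 0) (m≤n+m _ 2) forcing
      large = large-Nb G acyclic {suc k} δ≤deg m U len (+-cancelˡ-≤ 5 m 5 g≤10) u
        (≤-trans (+-monoˡ-≤ 2 (≤-reflexive len)) (≤-reflexive (+-comm (3 + m) 2)))
  -- From (δ - 1)(g - 2) + 2 ≤ |S| + (g - 2) it follows that |S| is at least (δ - 2)(g - 2) + 2,
  -- which equals δ + (δ - 2)(g - 3).
  in ≤-from (≤-trans large U≤)
       (≤-reflexive (≡.trans (eq k m (∣ S ∣)) (cong (λ l → ∣ S ∣ + (suc k * l + 2)) (≡.sym len))))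
  where
  ∉Nb[] : ∀ {x} → x ∉ Nb G []
  ∉Nb[] x∈ with ∈Nb⁻ G x∈
  ... | inj₁ ()
  ... | inj₂ (_ , () , _)
  eq : ∀ k m s → suc (suc k) + k * (2 + m) + (s + (3 + m)) ≡ s + (suc k * (3 + m) + 2)
  eq = solve-∀
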